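{- Let $n,k,t$ be integers with $n\ge1$ and $1\le t\le k$. Then the poset obtained from $\mathcal B_{n,k,t}$ by adjoining a new maximum element $\hat1$ is EL-shellable; in particular the order complex of $\mathcal B_{n,k,t}\setminus\{\hat0\}$ is homotopy equivalent to a wedge of $(n-1)$-dimensional spheres.
   Context: $\mathcal B_{n,k,t}$ is the poset whose elements are pairs consisting of an ordered $t$-tuple $(S_1,\dots,S_t)$ and an unordered collection $\{S_{t+1},\dots,S_k\}$ (a $(k-t)$-tuple up to permutation) of subsets $S_i\subseteq[n]$ that are pairwise disjoint (possibly empty). The order: $(S'_1,\dots,S'_t)\{S'_{t+1},\dots,S'_k\}\le(S_1,\dots,S_t)\{S_{t+1},\dots,S_k\}$ iff $S'_i\subseteq S_i$ for $i=1,\dots,t$ and there is a permutation $\pi$ of $\{t+1,\dots,k\}$ with $S'_i\subseteq S_{\pi(i)}$ for $i=t+1,\dots,k$. Its minimum $\hat0$ is the element with all $S_i=\emptyset$. EL-shellability is in the sense of Björner–Wachs. -}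

module Defs where

open import Level using (0ℓ)
open import Data.Nat using (ℕ; zero; suc; _<_)
open import Data.Fin using (Fin; toℕ)
open import Data.Fin.Subset using (Subset; _⊆_; _∩_; Empty)
open import Data.Fin.Permutation using (Permutation′; _⟨$⟩ʳ_)
open import Data.List using (List; []; _∷_)
open import Data.Product using (Σ; Σ-syntax; ∃; ∃-syntax; _×_; _,_; proj₁)
open import Data.Sum using (_⊎_)
open import Data.Empty using (⊥)
open import Data.Unit using (⊤)
open import Relation.Nullary using (¬_)
open import Relation.Binary.PropositionalEquality using (_≡_; _≢_)
open import Relation.Binary.Bundles using (Poset)

-- A k-tuple (S_1,…,S_k) of pairwise disjoint subsets of [n]
-- (index i : Fin k stands for S_{i+1}).
record Tuple (n k : ℕ) : Set where
  constructor mkTuple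
  field
    sets     : Fin k → Subset n
    disjoint : ∀ i j → i ≢ j → Empty (sets i ∩ sets j)
open Tuple public

-- Permutations of Fin k fixing the first t indices, i.e. permutations
-- of the "unordered" positions {t+1,…,k}.
FixesFirst : (t : ℕ) {k : ℕ} → Permutation′ k → Set
FixesFirst t σ = ∀ i → toℕ i < t → σ ⟨$⟩ʳ i ≡ i

-- Elements of B_{n,k,t} are tuples up to permutation of the last k−t
-- entries: we use tuples as carrier together with this equivalence.
_≈B_ : ∀ {n k} (t : ℕ) → Tuple n k → Tuple n k → Set
_≈B_ {k = k} t S′ S =
  Σ[ σ ∈ Permutation′ k ] (FixesFirst t σ × (∀ i → sets S′ i ≡ sets S (σ ⟨$⟩ʳ i)))

_≤B_ : ∀ {n k} (t : ℕ) → Tuple n k → Tuple n k → Set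
_≤B_ {k = k} t S′ S =
  Σ[ σ ∈ Permutation′ k ] (FixesFirst t σ × (∀ i → sets S′ i ⊆ sets S (σ ⟨$⟩ʳ i)))

data WithTop (A : Set) : Set where
  ⟪_⟫ : A → WithTop A
  top : WithTop A

liftRel : {A : Set} → (A → A → Set) → WithTop A → WithTop A → Set
liftRel R ⟪ x ⟫ ⟪ y ⟫ = R x y
liftRel R ⟪ x ⟫ top   = ⊥
liftRel R top   ⟪ y ⟫ = ⊥
liftRel R top   top   = ⊤

topLe : {A : Set} → (A → A → Set) → WithTop A → WithTop A → Set
topLe R x     top   = ⊤
topLe R top   ⟪ y ⟫ = ⊥
topLe R ⟪ x ⟫ ⟪ y ⟫ = R x y

B̂ : ℕ → ℕ → Set
B̂ n k = WithTop (Tuple n k)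

_≈̂_ : ∀ {n k} (t : ℕ) → B̂ n k → B̂ n k → Set
_≈̂_ t = liftRel (_≈B_ t)

_≤̂_ : ∀ {n k} (t : ℕ) → B̂ n k → B̂ n k → Set
_≤̂_ t = topLe (_≤B_ t)

-- EL-labelings (Björner–Wachs) of a finite bounded poset presented by a
-- carrier A, an equality _≈_ and a partial order _≤_ (up to _≈_).

module EL {A : Set} (_≈_ : A → A → Set) (_≤_ : A → A → Set) where

  _<ₚ_ : A → A → Set
  x <ₚ y = x ≤ y × ¬ (x ≈ y)

  _⋖_ : A → A → Set
  x ⋖ y = x <ₚ y × (∀ z → x <ₚ z → ¬ (z <ₚ y))

  -- A maximal chain x = x₀ ⋖ x₁ ⋖ … ⋖ x_m = y of the interval [x,y],
  -- given by the list [x₁,…,x_m].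
  MaxChain : A → A → List A → Set
  MaxChain x y []       = x ≈ y
  MaxChain x y (z ∷ zs) = x ⋖ z × MaxChain z y zs

  SameChain : List A → List A → Set
  SameChain []       []       = ⊤
  SameChain []       (_ ∷ _)  = ⊥
  SameChain (_ ∷ _)  []       = ⊥
  SameChain (a ∷ as) (b ∷ bs) = a ≈ b × SameChain as bs

  module Labels (Λ : Poset 0ℓ 0ℓ 0ℓ) where
    open Poset Λ renaming (Carrier to L; _≈_ to _≈L_; _≤_ to _≤L_)

    _<L_ : L → L → Set
    a <L b = a ≤L b × ¬ (a ≈L b)

    labels : (A → A → L) → A → List A → List L
    labels lab x []       = []
    labels lab x (z ∷ zs) = lab x z ∷ labels lab z zs

    Increasing : List L → Set
    Increasing []           = ⊤
    Increasing (a ∷ [])     = ⊤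
    Increasing (a ∷ b ∷ as) = a <L b × Increasing (b ∷ as)

    _<Lex_ : List L → List L → Set
    []       <Lex []       = ⊥
    []       <Lex (_ ∷ _)  = ⊤
    (_ ∷ _)  <Lex []       = ⊥
    (a ∷ as) <Lex (b ∷ bs) = a <L b ⊎ (a ≈L b × as <Lex bs)

    IsELLabeling : (A → A → L) → Set
    IsELLabeling lab =
      (∀ x x′ y y′ → x ≈ x′ → y ≈ y′ → x ⋖ y → lab x y ≈L lab x′ y′) ×
      (∀ x y → x <ₚ y →
        Σ[ c ∈ List A ] (MaxChain x y c × Increasing (labels lab x c) ×
          (∀ c′ → MaxChain x y c′ → ¬ SameChain c c′ →
             ¬ Increasing (labels lab x c′) × (labels lab x c <Lex labels lab x c′))))

  ELShellable : Set₁
  ELShellable =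
    Σ[ Λ ∈ Poset 0ℓ 0ℓ 0ℓ ] Σ[ lab ∈ (A → A → Poset.Carrier Λ) ] Labels.IsELLabeling Λ lab

{-# OPTIONS --safe #-}
-- A cover a ⋖ b of B_{n,k,t} inserts a single element e ∈ {0,…,n−1}; label it e if e lands in the
-- first block S₁ and n + 1 + e otherwise, and label every cover a ⋖ 1̂ by n. As t ≥ 1, S₁ is fixed
-- by the permutations defining the order, so labels are well defined. In an interval [a, y] below
-- 1̂ each element of y missing from a is inserted exactly once and always with the same label, so
-- the unique increasing maximal chain inserts them by increasing label, and it is lexicographically
-- first. In [a, 1̂] the last label n forces an increasing chain to insert every missing element
-- into S₁, again in increasing order. Both cases go by induction on the least missing label.
module Submission where

open import Defs
open import Data.Nat using (ℕ; _≤_)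

open import Data.Nat using (zero; suc; _+_; _<_; z≤n; s≤s)
open import Data.Nat.Properties
  using (≤-poset; ≤-refl; ≤-trans; <-trans; <-≤-trans; ≤∧≢⇒<; <⇒≤; <⇒≢; <⇒≱; <-asym;
         m≤m+n; m≤n+m; n≤1+n; +-identityʳ; +-suc; +-cancelˡ-≡; +-monoʳ-≤; suc-injective)
open import Data.Fin using (Fin; toℕ; _≟_)
open import Data.Fin.Properties using (any?; toℕ-injective; toℕ<n)
open import Data.Fin.Subset using (Subset; _∈_; _∉_; _⊆_; _∪_; _∩_; ⁅_⁆; Empty)
open import Data.Fin.Subset.Properties
  using (_∈?_; ⊆-antisym; ⊆-reflexive; x∈p∩q⁺; x∈p∩q⁻; x∈p∪q⁺; x∈p∪q⁻; x∈⁅x⁆; x∈⁅y⁆⇒x≡y)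
open import Data.Fin.Permutation using (Permutation′; _⟨$⟩ʳ_; _⟨$⟩ˡ_; inverseˡ; inverseʳ; flip; _∘ₚ_)
import Data.Fin.Permutation as Permutation
open import Data.List using (List; []; _∷_)
open import Data.Product using (∃; ∃-syntax; _×_; _,_; proj₁; proj₂; uncurry)
open import Data.Sum using (_⊎_; inj₁; inj₂)
open import Data.Empty using (⊥-elim)
open import Data.Unit using (tt)
open import Function.Bundles using (Injection)
open import Function.Properties.Inverse using (↔⇒↣)
open import Relation.Nullary using (¬_; Dec; yes; no)
open import Relation.Nullary.Decidable using (_×-dec_; ¬?; decidable-stable; map′)
open import Relation.Binary.Structures using (IsPartialOrder)
open import Relation.Binary.PropositionalEquality
  using (_≡_; _≢_; refl; sym; trans; cong; subst; subst₂; module ≡-Reasoning)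

withTop-isPartialOrder : {A : Set} {_≈_ _≤′_ : A → A → Set} →
  IsPartialOrder _≈_ _≤′_ → IsPartialOrder (liftRel _≈_) (topLe _≤′_)
withTop-isPartialOrder {_≈_ = _≈_} {_≤′_} po = record
  { isPreorder = record
    { isEquivalence = record
      { refl  = λ {x} → ≈⁺-refl x
      ; sym   = λ {x} {y} → ≈⁺-sym x y
      ; trans = λ {x} {y} {z} → ≈⁺-trans x y z
      }
    ; reflexive = λ {x} {y} → ≈⁺⇒≤⁺ x y
    ; trans     = λ {x} {y} {z} → ≤⁺-trans x y z
    }
  ; antisym = λ {x} {y} → ≤⁺-antisym x y
  }
  where
  module P = IsPartialOrder po

  ≈⁺-refl : ∀ x → liftRel _≈_ x x
  ≈⁺-refl ⟪ x ⟫ = P.Eq.refl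
  ≈⁺-refl top   = tt

  ≈⁺-sym : ∀ x y → liftRel _≈_ x y → liftRel _≈_ y x
  ≈⁺-sym ⟪ x ⟫ ⟪ y ⟫ x≈y = P.Eq.sym x≈y
  ≈⁺-sym top   top   _   = tt

  ≈⁺-trans : ∀ x y z → liftRel _≈_ x y → liftRel _≈_ y z → liftRel _≈_ x z
  ≈⁺-trans ⟪ x ⟫ ⟪ y ⟫ ⟪ z ⟫ x≈y y≈z = P.Eq.trans x≈y y≈z
  ≈⁺-trans top   top   top   _   _   = tt

  ≈⁺⇒≤⁺ : ∀ x y → liftRel _≈_ x y → topLe _≤′_ x y
  ≈⁺⇒≤⁺ ⟪ x ⟫ ⟪ y ⟫ x≈y = P.reflexive x≈y
  ≈⁺⇒≤⁺ top   top   _   = tt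

  ≤⁺-trans : ∀ x y z → topLe _≤′_ x y → topLe _≤′_ y z → topLe _≤′_ x z
  ≤⁺-trans ⟪ x ⟫ ⟪ y ⟫ ⟪ z ⟫ x≤y y≤z = P.trans x≤y y≤z
  ≤⁺-trans _     _     top   _   _   = tt
  ≤⁺-trans ⟪ x ⟫ top   ⟪ z ⟫ _   ()
  ≤⁺-trans top   top   ⟪ z ⟫ _   ()

  ≤⁺-antisym : ∀ x y → topLe _≤′_ x y → topLe _≤′_ y x → liftRel _≈_ x y
  ≤⁺-antisym ⟪ x ⟫ ⟪ y ⟫ x≤y y≤x = P.antisym x≤y y≤x
  ≤⁺-antisym top   top   _   _   = tt

module LexFirstChains {A : Set} {_≈_ _≤′_ : A → A → Set}
                      (isPartialOrder : IsPartialOrder _≈_ _≤′_) where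
  open IsPartialOrder isPartialOrder using (module Eq; reflexive; antisym) renaming (trans to ≤′-trans)
  open EL _≈_ _≤′_ public
  open Labels ≤-poset public

  <⇒<L : ∀ {l l′} → l < l′ → l <L l′
  <⇒<L l<l′ = <⇒≤ l<l′ , <⇒≢ l<l′

  <L⇒< : ∀ {l l′} → l <L l′ → l < l′
  <L⇒< (l≤l′ , l≢l′) = ≤∧≢⇒< l≤l′ l≢l′

  Increasing-tail : ∀ l ls → Increasing (l ∷ ls) → Increasing ls
  Increasing-tail _ []      _         = tt
  Increasing-tail _ (_ ∷ _) (_ , inc) = inc

  MaxChain⇒≤ : ∀ {x y} c → MaxChain x y c → x ≤′ y
  MaxChain⇒≤ []       x≈y         = reflexive x≈y
  MaxChain⇒≤ (_ ∷ zs) (x⋖z , z→y) = ≤′-trans (proj₁ (proj₁ x⋖z)) (MaxChain⇒≤ zs z→y)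

  ⋖-respˡ-≈ : ∀ {x x′ z} → x ≈ x′ → x′ ⋖ z → x ⋖ z
  ⋖-respˡ-≈ {x} {x′} x≈x′ ((x′≤z , x′≉z) , nothing-between) =
    (≤′-trans (reflexive x≈x′) x′≤z , λ x≈z → x′≉z (Eq.trans (Eq.sym x≈x′) x≈z)) ,
    λ w (x≤w , x≉w) → nothing-between w
      (≤′-trans (reflexive (Eq.sym x≈x′)) x≤w , λ x′≈w → x≉w (Eq.trans x≈x′ x′≈w))

  MaxChain-respˡ-≈ : ∀ {x x′ y} c → x ≈ x′ → MaxChain x′ y c → MaxChain x y c
  MaxChain-respˡ-≈ []      x≈x′ x′≈y          = Eq.trans x≈x′ x′≈y
  MaxChain-respˡ-≈ (_ ∷ _) x≈x′ (x′⋖z , z→y) = ⋖-respˡ-≈ x≈x′ x′⋖z , z→y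

  module _ (lab : A → A → ℕ) where
    LexFirst : A → A → List A → Set
    LexFirst x y c = MaxChain x y c × Increasing (labels lab x c) ×
      (∀ c′ → MaxChain x y c′ → ¬ SameChain c c′ →
         ¬ Increasing (labels lab x c′) × (labels lab x c <Lex labels lab x c′))

    lexFirst-unique : ∀ {x y} c → MaxChain x y c → Increasing (labels lab x c) →
                      (∀ c′ → MaxChain x y c′ → SameChain c c′) → LexFirst x y c
    lexFirst-unique c x→y inc unique = x→y , inc , λ c′ x→y′ c≠c′ → ⊥-elim (c≠c′ (unique c′ x→y′))

  module _ (lab : A → A → ℕ)
           (lab-cong : ∀ x x′ y y′ → x ≈ x′ → y ≈ y′ → x ⋖ y → lab x y ≡ lab x′ y′) where
    labels-respˡ-≈ : ∀ {x x′ y} c → x ≈ x′ → MaxChain x′ y c → labels lab x c ≡ labels lab x′ c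
    labels-respˡ-≈ []       _    _          = refl
    labels-respˡ-≈ (z ∷ zs) x≈x′ (x′⋖z , _) =
      cong (_∷ labels lab z zs) (lab-cong _ _ z z x≈x′ Eq.refl (⋖-respˡ-≈ x≈x′ x′⋖z))

    lexFirst-∷ : ∀ {x y b} cb → x ⋖ b → LexFirst lab b y cb →
      (∀ w → b ⋖ w → w ≤′ y → lab x b < lab b w) →
      (∀ z zs → x ⋖ z → MaxChain z y zs →
         z ≈ b ⊎ (lab x b < lab x z × ¬ Increasing (lab x z ∷ labels lab z zs))) →
      LexFirst lab x y (b ∷ cb)
    lexFirst-∷ {x} {y} {b} cb x⋖b (b→y , inc , b-first) b-least others =
      (x⋖b , b→y) , increasing cb b→y inc , compare
      where
      increasing : ∀ cs → MaxChain b y cs → Increasing (labels lab b cs) →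
                   Increasing (lab x b ∷ labels lab b cs)
      increasing []       _           _   = tt
      increasing (w ∷ ws) (b⋖w , w→y) inc = <⇒<L (b-least w b⋖w (MaxChain⇒≤ ws w→y)) , inc

      compare : ∀ c′ → MaxChain x y c′ → ¬ SameChain (b ∷ cb) c′ →
        ¬ Increasing (labels lab x c′) × (labels lab x (b ∷ cb) <Lex labels lab x c′)
      compare [] x≈y _ = ⊥-elim (proj₂ (proj₁ x⋖b)
        (antisym (proj₁ (proj₁ x⋖b)) (≤′-trans (MaxChain⇒≤ cb b→y) (reflexive (Eq.sym x≈y)))))
      compare (z ∷ zs) (x⋖z , z→y) c≠c′ with others z zs x⋖z z→y
      ... | inj₂ (lt , not-increasing) = not-increasing , inj₁ (<⇒<L lt)
      ... | inj₁ z≈b = not-increasing , inj₂ (same-first , lex)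
        where
        b→y′ : MaxChain b y zs
        b→y′ = MaxChain-respˡ-≈ zs (Eq.sym z≈b) z→y
        relabel : labels lab z zs ≡ labels lab b zs
        relabel = labels-respˡ-≈ zs z≈b b→y′
        same-first : lab x b ≡ lab x z
        same-first = lab-cong x x b z Eq.refl (Eq.sym z≈b) x⋖b
        cb-vs-zs : ¬ Increasing (labels lab b zs) × (labels lab b cb <Lex labels lab b zs)
        cb-vs-zs = b-first zs b→y′ λ same → c≠c′ (Eq.sym z≈b , same)
        lex : labels lab b cb <Lex labels lab z zs
        lex = subst (labels lab b cb <Lex_) (sym relabel) (proj₂ cb-vs-zs)
        not-increasing : ¬ Increasing (lab x z ∷ labels lab z zs)
        not-increasing inc′ = proj₁ cb-vs-zs (subst Increasing relabel (Increasing-tail _ _ inc′))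

least-missing-induction :
  ∀ {m} {X : Set} (Missing : X → Fin m → Set) → (∀ a e → Dec (Missing a e)) →
  (key : Fin m → ℕ) {bound : ℕ} → (∀ e → key e < bound) →
  (P : X → Set) →
  (∀ a → (∀ e → ¬ Missing a e) → P a) →
  (∀ a e → Missing a e → (∀ e′ → Missing a e′ → key e ≤ key e′) →
     (∀ b → (∀ e′ → Missing b e′ → key e < key e′) → P b) → P a) →
  ∀ a → P a
least-missing-induction Missing missing? key {bound} key<bound P complete extend a =
  go bound 0 refl a (λ _ _ → z≤n)
  where
  -- every missing key of a is at least j, and the fuel d = bound − j bounds the remaining steps
  go : ∀ d j → j + d ≡ bound → ∀ a → (∀ e → Missing a e → j ≤ key e) → P a
  go zero j j≡bound a above = complete a λ e missing →
    <⇒≱ (key<bound e) (subst (_≤ key e) (trans (sym (+-identityʳ j)) j≡bound) (above e missing))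
  go (suc d) j j+d≡bound a above with any? (λ e → missing? a e ×-dec (key e Data.Nat.≟ j))
  ... | yes (e , missing , key≡j) =
    extend a e missing (λ e′ missing′ → subst (_≤ key e′) (sym key≡j) (above e′ missing′))
      λ b above′ → go d (suc j) (trans (sym (+-suc j d)) j+d≡bound) b
        λ e′ missing′ → subst (_< key e′) key≡j (above′ e′ missing′)
  ... | no none = go d (suc j) (trans (sym (+-suc j d)) j+d≡bound) a
    λ e missing → ≤∧≢⇒< (above e missing) λ j≡key → none (e , missing , sym j≡key)

insertionLabel : ∀ {n} → Subset n → Fin n → ℕ
insertionLabel {n} S₁ e with e ∈? S₁
... | yes _ = toℕ e
... | no  _ = suc (n + toℕ e)

insertionLabel-∈ : ∀ {n} {S₁ : Subset n} {e : Fin n} → e ∈ S₁ → insertionLabel S₁ e ≡ toℕ e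
insertionLabel-∈ {n} {S₁} {e} e∈S₁ with e ∈? S₁
... | yes _    = refl
... | no  e∉S₁ = ⊥-elim (e∉S₁ e∈S₁)

insertionLabel-∉ : ∀ {n} {S₁ : Subset n} {e : Fin n} → e ∉ S₁ → insertionLabel S₁ e ≡ suc (n + toℕ e)
insertionLabel-∉ {n} {S₁} {e} e∉S₁ with e ∈? S₁
... | yes e∈S₁ = ⊥-elim (e∉S₁ e∈S₁)
... | no  _    = refl

toℕ≤insertionLabel : ∀ {n} {S₁ : Subset n} {e : Fin n} → toℕ e ≤ insertionLabel S₁ e
toℕ≤insertionLabel {n} {S₁} {e} with e ∈? S₁
... | yes _ = ≤-refl
... | no  _ = ≤-trans (m≤n+m (toℕ e) n) (n≤1+n _)

insertionLabel<1+2n : ∀ {n} (S₁ : Subset n) (e : Fin n) → insertionLabel S₁ e < suc (n + n)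
insertionLabel<1+2n {n} S₁ e with e ∈? S₁
... | yes _ = <-≤-trans (toℕ<n e) (≤-trans (m≤m+n n n) (n≤1+n _))
... | no  _ = s≤s (subst (_≤ n + n) (+-suc n (toℕ e)) (+-monoʳ-≤ n (toℕ<n e)))

insertionLabel<n⇒∈ : ∀ {n} {S₁ : Subset n} {e : Fin n} → insertionLabel S₁ e < n → e ∈ S₁
insertionLabel<n⇒∈ {n} {S₁} {e} label<n with e ∈? S₁
... | yes e∈S₁ = e∈S₁
... | no  _    = ⊥-elim (<-asym label<n (s≤s (m≤m+n n (toℕ e))))

insertionLabel-cong : ∀ {n} {S₁ T₁ : Subset n} {e : Fin n} →
  (e ∈ S₁ → e ∈ T₁) → (e ∈ T₁ → e ∈ S₁) → insertionLabel S₁ e ≡ insertionLabel T₁ e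
insertionLabel-cong {n} {S₁} {T₁} {e} to from with e ∈? S₁
... | yes e∈S₁ = sym (insertionLabel-∈ (to e∈S₁))
... | no  e∉S₁ = sym (insertionLabel-∉ λ e∈T₁ → e∉S₁ (from e∈T₁))

insertionLabel-injective : ∀ {n} (S₁ : Subset n) {e e′ : Fin n} →
  insertionLabel S₁ e ≡ insertionLabel S₁ e′ → e ≡ e′
insertionLabel-injective {n} S₁ {e} {e′} same with e ∈? S₁ | e′ ∈? S₁
... | yes _ | yes _ = toℕ-injective same
... | yes _ | no  _ = ⊥-elim (<-asym (subst (_< n) same (toℕ<n e)) (s≤s (m≤m+n n (toℕ e′))))
... | no  _ | yes _ = ⊥-elim (<-asym (subst (_< n) (sym same) (toℕ<n e′)) (s≤s (m≤m+n n (toℕ e))))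
... | no  _ | no  _ = toℕ-injective (+-cancelˡ-≡ n _ _ (suc-injective same))

permutation-injective : ∀ {k} (σ : Permutation′ k) {i j} → σ ⟨$⟩ʳ i ≡ σ ⟨$⟩ʳ j → i ≡ j
permutation-injective σ = Injection.injective (↔⇒↣ σ)

module _ (t : ℕ) {k : ℕ} where
  FixesFirst-id : FixesFirst t {k} Permutation.id
  FixesFirst-id _ _ = refl

  FixesFirst-flip : (σ : Permutation′ k) → FixesFirst t σ → FixesFirst t (flip σ)
  FixesFirst-flip σ fixes i i<t = trans (cong (σ ⟨$⟩ˡ_) (sym (fixes i i<t))) (inverseˡ σ)

  FixesFirst-∘ : (σ τ : Permutation′ k) → FixesFirst t σ → FixesFirst t τ → FixesFirst t (σ ∘ₚ τ)
  FixesFirst-∘ σ τ σ-fixes τ-fixes i i<t = trans (cong (τ ⟨$⟩ʳ_) (σ-fixes i i<t)) (τ-fixes i i<t)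

module TupleOrder {n k : ℕ} (t : ℕ) where
  infix 4 _≤ₜ_ _≈ₜ_ _∈⋃_ _∉⋃_

  _≤ₜ_ _≈ₜ_ : Tuple n k → Tuple n k → Set
  _≤ₜ_ = _≤B_ t
  _≈ₜ_ = _≈B_ t

  record _∈⋃_ (e : Fin n) (a : Tuple n k) : Set where
    constructor in-block
    field
      block  : Fin k
      member : e ∈ sets a block

  _∉⋃_ : Fin n → Tuple n k → Set
  e ∉⋃ a = ¬ e ∈⋃ a

  _∈⋃?_ : ∀ e a → Dec (e ∈⋃ a)
  e ∈⋃? a = map′ (λ (i , e∈i) → in-block {e} {a} i e∈i) (λ (in-block i e∈i) → i , e∈i)
                 (any? λ i → e ∈? sets a i)

  block-unique : ∀ (a : Tuple n k) {e i j} → e ∈ sets a i → e ∈ sets a j → i ≡ j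
  block-unique a {e} {i} {j} e∈i e∈j with i ≟ j
  ... | yes i≡j = i≡j
  ... | no  i≢j = ⊥-elim (disjoint a i j i≢j (e , x∈p∩q⁺ (e∈i , e∈j)))

  ⋃-mono : ∀ {a b e} → a ≤ₜ b → e ∈⋃ a → e ∈⋃ b
  ⋃-mono (σ , _ , ⊆σ) (in-block i e∈i) = in-block (σ ⟨$⟩ʳ i) (⊆σ i e∈i)

  ≈⇒≤ : ∀ {a b} → a ≈ₜ b → a ≤ₜ b
  ≈⇒≤ (σ , fixes , ≡σ) = σ , fixes , λ i → ⊆-reflexive (≡σ i)

  ≈-refl : ∀ {a} → a ≈ₜ a
  ≈-refl = Permutation.id , FixesFirst-id t {k} , λ _ → refl

  ≈-sym : ∀ {a b} → a ≈ₜ b → b ≈ₜ a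
  ≈-sym {a} {b} (σ , fixes , ≡σ) = flip σ , FixesFirst-flip t σ fixes , ≡σ⁻¹
    where
    ≡σ⁻¹ : ∀ i → sets b i ≡ sets a (σ ⟨$⟩ˡ i)
    ≡σ⁻¹ i = sym (trans (≡σ (σ ⟨$⟩ˡ i)) (cong (sets b) (inverseʳ σ)))

  ≈-trans : ∀ {a b c} → a ≈ₜ b → b ≈ₜ c → a ≈ₜ c
  ≈-trans (σ , σ-fixes , ≡σ) (τ , τ-fixes , ≡τ) =
    σ ∘ₚ τ , FixesFirst-∘ t σ τ σ-fixes τ-fixes , λ i → trans (≡σ i) (≡τ (σ ⟨$⟩ʳ i))

  ≤-trans′ : ∀ {a b c} → a ≤ₜ b → b ≤ₜ c → a ≤ₜ c
  ≤-trans′ (σ , σ-fixes , ⊆σ) (τ , τ-fixes , ⊆τ) =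
    σ ∘ₚ τ , FixesFirst-∘ t σ τ σ-fixes τ-fixes , λ i e∈a → ⊆τ (σ ⟨$⟩ʳ i) (⊆σ i e∈a)

  ∈⋃∧∉⋃⇒≉ : ∀ {a b e} → e ∈⋃ b → e ∉⋃ a → ¬ a ≈ₜ b
  ∈⋃∧∉⋃⇒≉ {a} {b} e∈b e∉a a≈b = e∉a (⋃-mono (≈⇒≤ {b} {a} (≈-sym {a} {b} a≈b)) e∈b)

  ≤∧⋃⊆⇒≈ : ∀ {a b} → a ≤ₜ b → (∀ {e} → e ∈⋃ b → e ∈⋃ a) → a ≈ₜ b
  ≤∧⋃⊆⇒≈ {a} {b} (σ , fixes , ⊆σ) ⋃b⊆⋃a = σ , fixes , λ i → ⊆-antisym (⊆σ i) (⊇σ i)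
    where
    ⊇σ : ∀ i → sets b (σ ⟨$⟩ʳ i) ⊆ sets a i
    ⊇σ i {e} e∈b with ⋃b⊆⋃a (in-block (σ ⟨$⟩ʳ i) e∈b)
    ... | in-block j e∈aj = subst (λ l → e ∈ sets a l)
                       (permutation-injective σ (block-unique b (⊆σ j e∈aj) e∈b)) e∈aj

  isPartialOrder : IsPartialOrder _≈ₜ_ _≤ₜ_
  isPartialOrder = record
    { isPreorder = record
      { isEquivalence = record
        { refl  = λ {a} → ≈-refl {a}
        ; sym   = λ {a} {b} → ≈-sym {a} {b}
        ; trans = λ {a} {b} {c} → ≈-trans {a} {b} {c}
        }
      ; reflexive = λ {a} {b} → ≈⇒≤ {a} {b}
      ; trans     = λ {a} {b} {c} → ≤-trans′ {a} {b} {c}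
      }
    ; antisym = λ {a} {b} a≤b b≤a → ≤∧⋃⊆⇒≈ {a} {b} a≤b (⋃-mono b≤a)
    }

  B̂-isPartialOrder : IsPartialOrder (_≈̂_ {n} {k} t) (_≤̂_ t)
  B̂-isPartialOrder = withTop-isPartialOrder isPartialOrder

  -- The blocks of a and b are matched through the blocks of y containing the same elements.
  ⋃⊆⇒≤ : ∀ {a b y} → a ≤ₜ y → b ≤ₜ y → (∀ {e} → e ∈⋃ a → e ∈⋃ b) → a ≤ₜ b
  ⋃⊆⇒≤ {a} {b} {y} (σ , σ-fixes , ⊆σ) (τ , τ-fixes , ⊆τ) ⋃a⊆⋃b =
    σ ∘ₚ flip τ , FixesFirst-∘ t σ (flip τ) σ-fixes (FixesFirst-flip t τ τ-fixes) , ⊆στ⁻¹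
    where
    ⊆στ⁻¹ : ∀ i → sets a i ⊆ sets b (τ ⟨$⟩ˡ (σ ⟨$⟩ʳ i))
    ⊆στ⁻¹ i {e} e∈a with ⋃a⊆⋃b (in-block i e∈a)
    ... | in-block j e∈bj = subst (λ l → e ∈ sets b l)
                            (trans (sym (inverseˡ τ)) (cong (τ ⟨$⟩ˡ_) y-block)) e∈bj
      where
      y-block : τ ⟨$⟩ʳ j ≡ σ ⟨$⟩ʳ i
      y-block = block-unique y (⊆τ j e∈bj) (⊆σ i e∈a)

  new-element : ∀ {a b} → a ≤ₜ b → ¬ a ≈ₜ b → ∃[ e ] e ∈⋃ b × e ∉⋃ a
  new-element {a} {b} a≤b a≉b with any? (λ e → e ∈⋃? b ×-dec ¬? (e ∈⋃? a))
  ... | yes found = found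
  ... | no  none  = ⊥-elim (a≉b (≤∧⋃⊆⇒≈ a≤b λ {e} e∈b →
                      decidable-stable (e ∈⋃? a) λ e∉a → none (e , e∈b , e∉a)))

  insertAt : (Fin k → Subset n) → Fin k → Fin n → Fin k → Subset n
  insertAt S p e i with i ≟ p
  ... | yes _ = S i ∪ ⁅ e ⁆
  ... | no  _ = S i

  module _ (S : Fin k → Subset n) (p : Fin k) (e : Fin n) where
    ∈-insertAt⁺ : ∀ {i x} → x ∈ S i → x ∈ insertAt S p e i
    ∈-insertAt⁺ {i} x∈S with i ≟ p
    ... | yes _ = x∈p∪q⁺ (inj₁ x∈S)
    ... | no  _ = x∈S

    ∈-insertAt-new : e ∈ insertAt S p e p
    ∈-insertAt-new with p ≟ p
    ... | yes _   = x∈p∪q⁺ (inj₂ (x∈⁅x⁆ e))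
    ... | no  p≢p = ⊥-elim (p≢p refl)

    ∈-insertAt⁻ : ∀ {i x} → x ∈ insertAt S p e i → x ∈ S i ⊎ (i ≡ p × x ≡ e)
    ∈-insertAt⁻ {i} x∈ with i ≟ p
    ... | no  _   = inj₁ x∈
    ... | yes i≡p with x∈p∪q⁻ (S i) _ x∈
    ...   | inj₁ x∈S = inj₁ x∈S
    ...   | inj₂ x∈e = inj₂ (i≡p , x∈⁅y⁆⇒x≡y e x∈e)

  record Adds (a b : Tuple n k) (e : Fin n) : Set where
    field
      extends : a ≤ₜ b
      added   : e ∈⋃ b
      fresh   : e ∉⋃ a
      only    : ∀ {f} → f ∈⋃ b → f ∉⋃ a → f ≡ e

  -- Opaque, so that a tuple can be inferred from an insert-term (its blocks do not determine it).
  opaque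
    insert : (a : Tuple n k) (p : Fin k) (e : Fin n) → e ∉⋃ a → Tuple n k
    insert a p e e∉a = mkTuple (insertAt (sets a) p e) disjoint′
      where
      disjoint′ : ∀ i j → i ≢ j → Empty (insertAt (sets a) p e i ∩ insertAt (sets a) p e j)
      disjoint′ i j i≢j (x , x∈i∩j) with x∈p∩q⁻ _ _ x∈i∩j
      ... | x∈i , x∈j with ∈-insertAt⁻ (sets a) p e x∈i | ∈-insertAt⁻ (sets a) p e x∈j
      ... | inj₁ x∈ai       | inj₁ x∈aj       = disjoint a i j i≢j (x , x∈p∩q⁺ (x∈ai , x∈aj))
      ... | inj₁ x∈ai       | inj₂ (_ , refl) = e∉a (in-block i x∈ai)
      ... | inj₂ (_ , refl) | inj₁ x∈aj       = e∉a (in-block j x∈aj)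
      ... | inj₂ (i≡p , _)  | inj₂ (j≡p , _)  = i≢j (trans i≡p (sym j≡p))

  opaque
    unfolding insert

    ∈-insert : ∀ {a p e e∉a} → e ∈ sets (insert a p e e∉a) p
    ∈-insert {a} {p} {e} = ∈-insertAt-new (sets a) p e

    insert-adds : ∀ {a p e e∉a} → Adds a (insert a p e e∉a) e
    insert-adds {a} {p} {e} {e∉a} = record
      { extends = Permutation.id , FixesFirst-id t {k} , λ i → ∈-insertAt⁺ (sets a) p e
      ; added   = in-block p (∈-insert {a} {p} {e} {e∉a})
      ; fresh   = e∉a
      ; only    = only
      }
      where
      only : ∀ {f} → f ∈⋃ insert a p e e∉a → f ∉⋃ a → f ≡ e
      only (in-block i f∈) f∉a with ∈-insertAt⁻ (sets a) p e f∈
      ... | inj₁ f∈a       = ⊥-elim (f∉a (in-block i f∈a))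
      ... | inj₂ (_ , f≡e) = f≡e

    insert-≤ : ∀ {a p e e∉a y} ((σ , _) : a ≤ₜ y) → e ∈ sets y (σ ⟨$⟩ʳ p) → insert a p e e∉a ≤ₜ y
    insert-≤ {a} {p} {e} {y = y} (σ , fixes , ⊆σ) e∈y = σ , fixes , ⊆σ′
      where
      ⊆σ′ : ∀ i → insertAt (sets a) p e i ⊆ sets y (σ ⟨$⟩ʳ i)
      ⊆σ′ i x∈ with ∈-insertAt⁻ (sets a) p e x∈
      ... | inj₁ x∈a           = ⊆σ i x∈a
      ... | inj₂ (refl , refl) = e∈y

  insert-below : ∀ {a y e} → a ≤ₜ y → e ∈⋃ y → e ∉⋃ a → ∃[ b ] Adds a b e × b ≤ₜ y
  insert-below {a} {y} {e} a≤y@(σ , _) (in-block q e∈q) e∉a =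
    insert a (σ ⟨$⟩ˡ q) e e∉a , insert-adds ,
    insert-≤ {y = y} a≤y (subst (λ i → e ∈ sets y i) (sym (inverseʳ σ)) e∈q)

  same-addition-⋃ : ∀ {a b c e} → Adds a b e → Adds a c e → ∀ {x} → x ∈⋃ b → x ∈⋃ c
  same-addition-⋃ {a} adds-b adds-c {x} x∈b with x ∈⋃? a
  ... | yes x∈a = ⋃-mono (Adds.extends adds-c) x∈a
  ... | no  x∉a = subst (_∈⋃ _) (sym (Adds.only adds-b x∈b x∉a)) (Adds.added adds-c)

  Adds-∉ : ∀ {a b e f} → Adds a b e → f ∉⋃ b → f ∉⋃ a × f ≢ e
  Adds-∉ adds f∉b = (λ f∈a → f∉b (⋃-mono (Adds.extends adds) f∈a)) , λ { refl → f∉b (Adds.added adds) }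

module Covers {n k : ℕ} (t : ℕ) where
  open TupleOrder {n} {k} t
  open LexFirstChains B̂-isPartialOrder public

  adds⇒⋖ : ∀ {a b e} → Adds a b e → ⟪ a ⟫ ⋖ ⟪ b ⟫
  adds⇒⋖ {a} {b} adds = (extends , ∈⋃∧∉⋃⇒≉ added fresh) , nothing-between
    where
    open Adds adds
    nothing-between : ∀ z → ⟪ a ⟫ <ₚ z → ¬ z <ₚ ⟪ b ⟫
    nothing-between top   _           (() , _)
    nothing-between ⟪ z ⟫ (a≤z , a≉z) (z≤b , z≉b)
      with new-element {a} {z} a≤z a≉z | new-element {z} {b} z≤b z≉b
    ... | f , f∈z , f∉a | g , g∈b , g∉z = g∉z (subst (_∈⋃ z) (trans f≡e (sym g≡e)) f∈z)
      where
      f≡e = only (⋃-mono z≤b f∈z) f∉a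
      g≡e = only g∈b λ g∈a → g∉z (⋃-mono a≤z g∈a)

  ⋖⇒adds : ∀ {a b} → ⟪ a ⟫ ⋖ ⟪ b ⟫ → ∃ (Adds a b)
  ⋖⇒adds {a} {b} ((a≤b , a≉b) , nothing-between) with new-element {a} {b} a≤b a≉b
  ... | e , e∈b , e∉a = e , record { extends = a≤b ; added = e∈b ; fresh = e∉a ; only = only }
    where
    only : ∀ {f} → f ∈⋃ b → f ∉⋃ a → f ≡ e
    only {f} f∈b f∉a with insert-below {a} {b} a≤b e∈b e∉a
    -- inserting e alone gives an element strictly between a and b unless f = e
    ... | c , adds-c , c≤b = decidable-stable (f ≟ e) λ f≢e →
      nothing-between ⟪ c ⟫ (proj₁ (adds⇒⋖ adds-c))
        (c≤b , ∈⋃∧∉⋃⇒≉ f∈b λ f∈c → f≢e (Adds.only adds-c f∈c f∉a))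

  adds-≈ : ∀ {a b c e} → Adds a b e → Adds a c e → b ≤ₜ c → b ≈ₜ c
  adds-≈ {b = b} {c} adds-b adds-c b≤c = ≤∧⋃⊆⇒≈ {b} {c} b≤c (same-addition-⋃ adds-c adds-b)

  Adds-resp-≈ : ∀ {a a′ b b′ e} → a ≈ₜ a′ → b ≈ₜ b′ → Adds a b e → Adds a′ b′ e
  Adds-resp-≈ {a} {a′} {b} {b′} a≈a′ b≈b′ adds = record
    { extends = ≤-trans′ {a′} {a} {b′} (≈⇒≤ {a′} {a} (≈-sym {a} {a′} a≈a′))
                  (≤-trans′ {a} {b} {b′} extends (≈⇒≤ {b} {b′} b≈b′))
    ; added   = ⋃-mono (≈⇒≤ {b} {b′} b≈b′) added
    ; fresh   = λ e∈a′ → fresh (⋃-mono (≈⇒≤ {a′} {a} (≈-sym {a} {a′} a≈a′)) e∈a′)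
    ; only    = λ f∈b′ f∉a′ → only (⋃-mono (≈⇒≤ {b′} {b} (≈-sym {b} {b′} b≈b′)) f∈b′)
                                   (λ f∈a → f∉a′ (⋃-mono (≈⇒≤ {a} {a′} a≈a′) f∈a))
    }
    where open Adds adds

  Complete : Tuple n k → Set
  Complete a = ∀ e → e ∈⋃ a

  complete⇒⋖top : ∀ {a} → Complete a → ⟪ a ⟫ ⋖ top
  complete⇒⋖top {a} complete = (tt , λ ()) , nothing-between
    where
    nothing-between : ∀ z → ⟪ a ⟫ <ₚ z → ¬ z <ₚ top
    nothing-between ⟪ z ⟫ (a≤z , a≉z) _ with new-element {a} {z} a≤z a≉z
    ... | e , _ , e∉a = e∉a (complete e)
    nothing-between top   _ (_ , top≉top) = top≉top tt

  ⋖top⇒complete : Fin k → ∀ {a} → ⟪ a ⟫ ⋖ top → Complete a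
  ⋖top⇒complete p {a} (_ , nothing-between) e = decidable-stable (e ∈⋃? a) λ e∉a →
    nothing-between ⟪ insert a p e e∉a ⟫ (proj₁ (adds⇒⋖ insert-adds)) (tt , λ ())

  top-maximal : ∀ {w} → ¬ top ⋖ w
  top-maximal {⟪ w ⟫} ((() , _) , _)
  top-maximal {top}   ((_ , top≉top) , _) = top≉top tt

module Labelling (n k′ t : ℕ) (1≤t : 1 ≤ t) where
  open TupleOrder {n} {suc k′} t
  open Covers {n} {suc k′} t

  first-block : Fin (suc k′)
  first-block = Data.Fin.zero

  S₁ : Tuple n (suc k′) → Subset n
  S₁ a = sets a first-block

  fixes-first-block : ∀ (σ : Permutation′ (suc k′)) → FixesFirst t σ → σ ⟨$⟩ʳ first-block ≡ first-block
  fixes-first-block _ fixes = fixes first-block 1≤t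

  S₁-≈ : ∀ {a b} → a ≈ₜ b → S₁ a ≡ S₁ b
  S₁-≈ {b = b} (σ , fixes , ≡σ) = trans (≡σ first-block) (cong (sets b) (fixes-first-block σ fixes))

  S₁-≤ : ∀ {a b} → a ≤ₜ b → S₁ a ⊆ S₁ b
  S₁-≤ {b = b} (σ , fixes , ⊆σ) e∈ =
    subst (λ i → _ ∈ sets b i) (fixes-first-block σ fixes) (⊆σ first-block e∈)

  S₁-reflect : ∀ {a b e} → a ≤ₜ b → e ∈⋃ a → e ∈ S₁ b → e ∈ S₁ a
  S₁-reflect {a} {b} {e} (σ , fixes , ⊆σ) (in-block i e∈i) e∈S₁b =
    subst (λ j → e ∈ sets a j) i≡first e∈i
    where
    i≡first : i ≡ first-block
    i≡first = permutation-injective σ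
      (trans (block-unique b (⊆σ i e∈i) e∈S₁b) (sym (fixes-first-block σ fixes)))

  -- Only the values on covers matter; 0 elsewhere is arbitrary.
  label : B̂ n (suc k′) → B̂ n (suc k′) → ℕ
  label ⟪ a ⟫ ⟪ b ⟫ with any? (λ e → e ∈⋃? b ×-dec ¬? (e ∈⋃? a))
  ... | yes (e , _) = insertionLabel (S₁ b) e
  ... | no  _       = 0
  label ⟪ _ ⟫ top = n
  label top   _   = 0

  label-adds : ∀ {a b e} → Adds a b e → label ⟪ a ⟫ ⟪ b ⟫ ≡ insertionLabel (S₁ b) e
  label-adds {a} {b} {e} adds with any? (λ e → e ∈⋃? b ×-dec ¬? (e ∈⋃? a))
  ... | yes (f , f∈b , f∉a) = cong (insertionLabel (S₁ b)) (Adds.only adds f∈b f∉a)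
  ... | no  none            = ⊥-elim (none (e , Adds.added adds , Adds.fresh adds))

  label-cong : ∀ x x′ y y′ → _≈̂_ t x x′ → _≈̂_ t y y′ → x ⋖ y → label x y ≡ label x′ y′
  label-cong ⟪ a ⟫ ⟪ a′ ⟫ ⟪ b ⟫ ⟪ b′ ⟫ a≈a′ b≈b′ a⋖b with ⋖⇒adds a⋖b
  ... | e , adds = begin
    label ⟪ a ⟫ ⟪ b ⟫        ≡⟨ label-adds adds ⟩
    insertionLabel (S₁ b) e  ≡⟨ cong (λ S → insertionLabel S e) (S₁-≈ {b} {b′} b≈b′) ⟩
    insertionLabel (S₁ b′) e ≡⟨ label-adds (Adds-resp-≈ a≈a′ b≈b′ adds) ⟨
    label ⟪ a′ ⟫ ⟪ b′ ⟫      ∎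
    where open ≡-Reasoning
  label-cong ⟪ _ ⟫ ⟪ _ ⟫ top   top   _ _ _     = refl
  label-cong top   top   y     _     _ _ top⋖y = ⊥-elim (top-maximal top⋖y)

  module Below (y : Tuple n (suc k′)) where
    key : Fin n → ℕ
    key = insertionLabel (S₁ y)

    Missing : Tuple n (suc k′) → Fin n → Set
    Missing a e = e ∈⋃ y × e ∉⋃ a

    Missing-adds : ∀ {a b e e′} → Adds a b e → Missing b e′ → Missing a e′ × e′ ≢ e
    Missing-adds adds (e′∈y , e′∉b) = let e′∉a , e′≢e = Adds-∉ adds e′∉b in (e′∈y , e′∉a) , e′≢e

    LeastMissing : Tuple n (suc k′) → Fin n → Set
    LeastMissing a e = ∀ e′ → Missing a e′ → key e ≤ key e′

    least⇒< : ∀ {a e e′} → LeastMissing a e → Missing a e′ → e′ ≢ e → key e < key e′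
    least⇒< least missing′ e′≢e =
      ≤∧≢⇒< (least _ missing′) λ same → e′≢e (insertionLabel-injective (S₁ y) (sym same))

    label-adds-below : ∀ {a w e} → Adds a w e → w ≤ₜ y → label ⟪ a ⟫ ⟪ w ⟫ ≡ key e
    label-adds-below {w = w} adds w≤y =
      trans (label-adds adds)
        (insertionLabel-cong (S₁-≤ {w} {y} w≤y) (S₁-reflect {w} {y} w≤y (Adds.added adds)))

    label-below : ∀ {a w} → ⟪ a ⟫ ⋖ ⟪ w ⟫ → w ≤ₜ y →
                  ∃[ e ] Adds a w e × Missing a e × label ⟪ a ⟫ ⟪ w ⟫ ≡ key e
    label-below a⋖w w≤y with ⋖⇒adds a⋖w
    ... | e , adds =
      e , adds , (⋃-mono w≤y (Adds.added adds) , Adds.fresh adds) , label-adds-below adds w≤y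

    increasing⇒<key : ∀ {z l e} zs → MaxChain ⟪ z ⟫ ⟪ y ⟫ zs → Missing z e →
                      Increasing (l ∷ labels label ⟪ z ⟫ zs) → l < key e
    increasing⇒<key {z} []           z≈y         (e∈y , e∉z) _ =
      ⊥-elim (e∉z (⋃-mono (≈⇒≤ {y} {z} (≈-sym {z} {y} z≈y)) e∈y))
    increasing⇒<key (top ∷ ws)   (_ , top→y) _ _ = ⊥-elim (MaxChain⇒≤ ws top→y)
    increasing⇒<key {e = e} (⟪ w ⟫ ∷ ws) (z⋖w , w→y) (e∈y , e∉z) (l<lw , inc)
      with label-below z⋖w (MaxChain⇒≤ ws w→y)
    ... | e′ , adds , _ , lw≡ke′ with e′ ≟ e
    ...   | yes refl = subst (_ <_) lw≡ke′ (<L⇒< l<lw)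
    ...   | no  e′≢e = <-trans (<L⇒< l<lw)
      (increasing⇒<key ws w→y (e∈y , λ e∈w → e′≢e (sym (Adds.only adds e∈w e∉z))) inc)

    other-covers-below : ∀ {a b e} → Adds a b e → b ≤ₜ y → LeastMissing a e →
      ∀ z zs → ⟪ a ⟫ ⋖ z → MaxChain z ⟪ y ⟫ zs →
      _≈̂_ t z ⟪ b ⟫ ⊎
      (label ⟪ a ⟫ ⟪ b ⟫ < label ⟪ a ⟫ z × ¬ Increasing (label ⟪ a ⟫ z ∷ labels label z zs))
    other-covers-below _ _ _ top zs _ top→y = ⊥-elim (MaxChain⇒≤ zs top→y)
    other-covers-below {a} {b} {e} adds b≤y least ⟪ z ⟫ zs a⋖z z→y
      with label-below a⋖z (MaxChain⇒≤ zs z→y)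
    ... | e′ , adds′ , missing′ , lz≡ke′ with e′ ≟ e
    ...   | yes refl = inj₁ (≈-sym {b} {z} (adds-≈ adds adds′ b≤z))
      where
      b≤z = ⋃⊆⇒≤ {b} {z} {y} b≤y (MaxChain⇒≤ zs z→y) (same-addition-⋃ adds adds′)
    ...   | no  e′≢e = inj₂ (lb<lz , not-increasing)
      where
      lb<lz : label ⟪ a ⟫ ⟪ b ⟫ < label ⟪ a ⟫ ⟪ z ⟫
      lb<lz = subst₂ _<_ (sym (label-adds-below adds b≤y)) (sym lz≡ke′) (least⇒< least missing′ e′≢e)
      e-missing : Missing z e
      e-missing = ⋃-mono b≤y (Adds.added adds) ,
                  λ e∈z → e′≢e (sym (Adds.only adds′ e∈z (Adds.fresh adds)))
      not-increasing : ¬ Increasing (label ⟪ a ⟫ ⟪ z ⟫ ∷ labels label ⟪ z ⟫ zs)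
      not-increasing inc = <-asym lb<lz
        (subst (_ <_) (sym (label-adds-below adds b≤y)) (increasing⇒<key zs z→y e-missing inc))

    lexFirst-below-∷ : ∀ {a b e} cb → Adds a b e → b ≤ₜ y → LeastMissing a e →
      LexFirst label ⟪ b ⟫ ⟪ y ⟫ cb → LexFirst label ⟪ a ⟫ ⟪ y ⟫ (⟪ b ⟫ ∷ cb)
    lexFirst-below-∷ {a} {b} cb adds b≤y least b-first =
      lexFirst-∷ label label-cong cb (adds⇒⋖ adds) b-first b-least (other-covers-below adds b≤y least)
      where
      b-least : ∀ w → ⟪ b ⟫ ⋖ w → _≤̂_ t w ⟪ y ⟫ → label ⟪ a ⟫ ⟪ b ⟫ < label ⟪ b ⟫ w
      b-least ⟪ w ⟫ b⋖w w≤y with label-below b⋖w w≤y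
      ... | e′ , _ , missing′ , lw≡ke′ =
        subst₂ _<_ (sym (label-adds-below adds b≤y)) (sym lw≡ke′)
          (uncurry (least⇒< least) (Missing-adds adds missing′))

    nothing-missing⇒lexFirst : ∀ {a} → a ≤ₜ y → (∀ e → ¬ Missing a e) → LexFirst label ⟪ a ⟫ ⟪ y ⟫ []
    nothing-missing⇒lexFirst {a} a≤y nothing-missing = lexFirst-unique label [] a≈y tt only-[]
      where
      a≈y : a ≈ₜ y
      a≈y = ≤∧⋃⊆⇒≈ {a} {y} a≤y λ {e} e∈y →
        decidable-stable (e ∈⋃? a) λ e∉a → nothing-missing e (e∈y , e∉a)
      only-[] : ∀ c′ → MaxChain ⟪ a ⟫ ⟪ y ⟫ c′ → SameChain [] c′
      only-[] []           _           = tt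
      only-[] (top ∷ ws)   (_ , top→y) = ⊥-elim (MaxChain⇒≤ ws top→y)
      only-[] (⟪ w ⟫ ∷ ws) (a⋖w , w→y) with label-below a⋖w (MaxChain⇒≤ ws w→y)
      ... | e , _ , missing , _ = ⊥-elim (nothing-missing e missing)

    lexFirst-below : ∀ a → a ≤ₜ y → ∃ (LexFirst label ⟪ a ⟫ ⟪ y ⟫)
    lexFirst-below = least-missing-induction Missing (λ a e → e ∈⋃? y ×-dec ¬? (e ∈⋃? a))
      key (insertionLabel<1+2n (S₁ y)) _ (λ a none a≤y → [] , nothing-missing⇒lexFirst a≤y none) extend
      where
      extend : ∀ a e → Missing a e → LeastMissing a e →
        (∀ b → (∀ e′ → Missing b e′ → key e < key e′) → b ≤ₜ y → ∃ (LexFirst label ⟪ b ⟫ ⟪ y ⟫)) →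
        a ≤ₜ y → ∃ (LexFirst label ⟪ a ⟫ ⟪ y ⟫)
      extend a e (e∈y , e∉a) least lexFirst-from a≤y with insert-below {a} {y} a≤y e∈y e∉a
      ... | b , adds , b≤y = ⟪ b ⟫ ∷ proj₁ b-first , lexFirst-below-∷ _ adds b≤y least (proj₂ b-first)
        where
        b-first : ∃ (LexFirst label ⟪ b ⟫ ⟪ y ⟫)
        b-first = lexFirst-from b (λ _ missing′ → uncurry (least⇒< least) (Missing-adds adds missing′)) b≤y

  module ToTop where
    Missing : Tuple n (suc k′) → Fin n → Set
    Missing a e = e ∉⋃ a

    increasing⇒<n : ∀ {z l} zs → MaxChain ⟪ z ⟫ top zs → Increasing (l ∷ labels label ⟪ z ⟫ zs) → l < n
    increasing⇒<n (top ∷ _)    _           (l<n , _)    = <L⇒< l<n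
    increasing⇒<n (⟪ _ ⟫ ∷ ws) (_ , w→top) (l<lw , inc) =
      <-trans (<L⇒< l<lw) (increasing⇒<n ws w→top inc)

    increasing⇒<key : ∀ {z l e} zs → MaxChain ⟪ z ⟫ top zs → e ∉⋃ z →
                      Increasing (l ∷ labels label ⟪ z ⟫ zs) → l < toℕ e
    increasing⇒<key (top ∷ _) (z⋖top , _) e∉z _ = ⊥-elim (e∉z (⋖top⇒complete first-block z⋖top _))
    increasing⇒<key {e = e} (⟪ w ⟫ ∷ ws) (z⋖w , w→top) e∉z (l<lw , inc) with ⋖⇒adds z⋖w
    ... | e′ , adds with e′ ≟ e
    ...   | no  e′≢e = <-trans (<L⇒< l<lw)
      (increasing⇒<key ws w→top (λ e∈w → e′≢e (sym (Adds.only adds e∈w e∉z))) inc)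
    ...   | yes refl = subst (_ <_) lw≡e (<L⇒< l<lw)
      where
      -- an increasing chain to 1̂ stays below the label n of its last step, hence inserts into S₁
      lw<n : insertionLabel (S₁ w) e < n
      lw<n = subst (_< n) (label-adds adds) (increasing⇒<n ws w→top inc)
      lw≡e : label ⟪ _ ⟫ ⟪ w ⟫ ≡ toℕ e
      lw≡e = trans (label-adds adds) (insertionLabel-∈ (insertionLabel<n⇒∈ lw<n))

    LeastMissing : Tuple n (suc k′) → Fin n → Set
    LeastMissing a e = ∀ e′ → Missing a e′ → toℕ e ≤ toℕ e′

    least⇒< : ∀ {a e e′} → LeastMissing a e → Missing a e′ → e′ ≢ e → toℕ e < toℕ e′
    least⇒< least missing′ e′≢e = ≤∧≢⇒< (least _ missing′) λ same → e′≢e (toℕ-injective (sym same))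

    module InsertLeast {a e} (e∉a : e ∉⋃ a) (least : LeastMissing a e) where
      b : Tuple n (suc k′)
      b = insert a first-block e e∉a

      label-a-b : label ⟪ a ⟫ ⟪ b ⟫ ≡ toℕ e
      label-a-b = trans (label-adds insert-adds) (insertionLabel-∈ ∈-insert)

      other-covers-top : ∀ z zs → ⟪ a ⟫ ⋖ z → MaxChain z top zs →
        _≈̂_ t z ⟪ b ⟫ ⊎
        (label ⟪ a ⟫ ⟪ b ⟫ < label ⟪ a ⟫ z × ¬ Increasing (label ⟪ a ⟫ z ∷ labels label z zs))
      other-covers-top top _ a⋖top _ = ⊥-elim (e∉a (⋖top⇒complete first-block a⋖top e))
      other-covers-top ⟪ z ⟫ zs a⋖z z→top with ⋖⇒adds a⋖z
      ... | e′ , adds′ with e′ ≟ e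
      ...   | no e′≢e = inj₂ (lb<lz , not-increasing)
        where
        lb<lz : label ⟪ a ⟫ ⟪ b ⟫ < label ⟪ a ⟫ ⟪ z ⟫
        lb<lz = subst₂ _<_ (sym label-a-b) (sym (label-adds adds′))
                  (<-≤-trans (least⇒< least (Adds.fresh adds′) e′≢e) toℕ≤insertionLabel)
        not-increasing : ¬ Increasing (label ⟪ a ⟫ ⟪ z ⟫ ∷ labels label ⟪ z ⟫ zs)
        not-increasing inc = <-asym lb<lz (subst (_ <_) (sym label-a-b)
          (increasing⇒<key zs z→top (λ e∈z → e′≢e (sym (Adds.only adds′ e∈z e∉a))) inc))
      ...   | yes refl with e ∈? S₁ z
      ...     | yes e∈S₁z = inj₁ (≈-sym {b} {z} (adds-≈ insert-adds adds′ b≤z))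
        where
        b≤z : b ≤ₜ z
        b≤z with Adds.extends adds′
        ... | σ , fixes , ⊆σ = insert-≤ {y = z} (σ , fixes , ⊆σ)
                                 (subst (λ i → e ∈ sets z i) (sym (fixes-first-block σ fixes)) e∈S₁z)
      ...     | no  e∉S₁z = inj₂ (lb<lz , not-increasing)
        where
        lb<lz : label ⟪ a ⟫ ⟪ b ⟫ < label ⟪ a ⟫ ⟪ z ⟫
        lb<lz = subst₂ _<_ (sym label-a-b) (sym (trans (label-adds adds′) (insertionLabel-∉ e∉S₁z)))
                  (s≤s (m≤n+m (toℕ e) n))
        not-increasing : ¬ Increasing (label ⟪ a ⟫ ⟪ z ⟫ ∷ labels label ⟪ z ⟫ zs)
        not-increasing inc =
          e∉S₁z (insertionLabel<n⇒∈ (subst (_< n) (label-adds adds′) (increasing⇒<n zs z→top inc)))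

      lexFirst-top-∷ : ∀ cb → LexFirst label ⟪ b ⟫ top cb → LexFirst label ⟪ a ⟫ top (⟪ b ⟫ ∷ cb)
      lexFirst-top-∷ cb b-first =
        lexFirst-∷ label label-cong cb (adds⇒⋖ insert-adds) b-first b-least other-covers-top
        where
        b-least : ∀ w → ⟪ b ⟫ ⋖ w → _≤̂_ t w top → label ⟪ a ⟫ ⟪ b ⟫ < label ⟪ b ⟫ w
        b-least top   _   _ = subst (_< n) (sym label-a-b) (toℕ<n e)
        b-least ⟪ w ⟫ b⋖w _ with ⋖⇒adds b⋖w
        ... | e′ , adds′ = subst₂ _<_ (sym label-a-b) (sym (label-adds adds′))
          (<-≤-trans (uncurry (least⇒< least) (Adds-∉ insert-adds (Adds.fresh adds′)))
                     toℕ≤insertionLabel)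

    complete⇒lexFirst : ∀ {a} → Complete a → LexFirst label ⟪ a ⟫ top (top ∷ [])
    complete⇒lexFirst {a} complete =
      lexFirst-unique label (top ∷ []) (complete⇒⋖top complete , tt) tt only-top
      where
      only-top : ∀ c′ → MaxChain ⟪ a ⟫ top c′ → SameChain (top ∷ []) c′
      only-top (top ∷ [])     _               = tt , tt
      only-top (top ∷ w ∷ _)  (_ , top⋖w , _) = ⊥-elim (top-maximal top⋖w)
      only-top (⟪ z ⟫ ∷ _)    (a⋖z , _)       with ⋖⇒adds a⋖z
      ... | _ , adds = ⊥-elim (Adds.fresh adds (complete _))

    lexFirst-top : ∀ a → ∃ (LexFirst label ⟪ a ⟫ top)
    lexFirst-top = least-missing-induction Missing (λ a e → ¬? (e ∈⋃? a)) toℕ toℕ<n _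
      (λ a none → top ∷ [] , complete⇒lexFirst λ e → decidable-stable (e ∈⋃? a) (none e)) extend
      where
      extend : ∀ a e → Missing a e → LeastMissing a e →
        (∀ b → (∀ e′ → Missing b e′ → toℕ e < toℕ e′) → ∃ (LexFirst label ⟪ b ⟫ top)) →
        ∃ (LexFirst label ⟪ a ⟫ top)
      extend a e e∉a least lexFirst-from = ⟪ b ⟫ ∷ proj₁ b-first , lexFirst-top-∷ _ (proj₂ b-first)
        where
        open InsertLeast e∉a least
        b-first : ∃ (LexFirst label ⟪ b ⟫ top)
        b-first = lexFirst-from b λ e′ e′∉b → uncurry (least⇒< least) (Adds-∉ insert-adds e′∉b)

  isELLabeling : IsELLabeling label
  isELLabeling = label-cong , intervals
    where
    intervals : ∀ x y → x <ₚ y → ∃ (LexFirst label x y)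
    intervals ⟪ a ⟫ ⟪ y ⟫ (a≤y , _)   = Below.lexFirst-below y a a≤y
    intervals ⟪ a ⟫ top   _           = ToTop.lexFirst-top a
    intervals top   top   (_ , top≉top) = ⊥-elim (top≉top tt)

lemma6p2 : (n k t : ℕ) → 1 ≤ n → 1 ≤ t → t ≤ k →
    EL.ELShellable {B̂ n k} (_≈̂_ t) (_≤̂_ t)
lemma6p2 n zero     zero    _ ()  _
lemma6p2 n zero     (suc t) _ _   ()
lemma6p2 n (suc k′) t       _ 1≤t _ = ≤-poset , label , isELLabeling
  where open Labelling n k′ t 1≤t
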